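{- Let $\lambda$ be a partition and $n\in N(\lambda)$. In infinitely many variables $x=(x_1,x_2,\dots)$, \[\mathrm{ss}_{\lambda,n}(x)=\sum_{O\in\mathrm{OT}_n(\lambda)}F_{\mathrm{des}\,O}(x).\]
   Context: Partitions are Young diagrams (English convention); a box is a position $(i,j)$, $i$ = row, $j$ = column. For boxes $B_1=(i_1,j_1)$, $B_2=(i_2,j_2)$ write $B_1<_{nE}B_2$ if $i_1\ge i_2$ and $j_1<j_2$. A skew shape is a horizontal strip if it has at most one box in each column. $N(\lambda)=\{n\ge|\lambda|: n\equiv|\lambda|\pmod 2\}$. Compositions: weak (nonnegative parts, trailing zeros ignored) and strong (positive parts). For a weak composition $c$, $\flat(c)$ deletes its zero parts, and $x^c=\prod_i x_i^{c_i}$. For a strong composition $b$, $M_b(x)=\sum_{c:\ \flat(c)=b}x^c$. A strong composition $b$ refines $a=(a_1,\dots,a_m)$ if it is obtained by splitting each $a_j$, in order, into positive parts summing to $a_j$; $\mathrm{ref}(a)$ is the set of such $b$ (including $a$), and $F_a(x)=\sum_{b\in\mathrm{ref}(a)}M_b(x)$ is the fundamental quasi-symmetric function. For partitions write $\nu\lhd\mu$ if $\nu\subset\mu$, $|\mu|=|\nu|+1$. An oscillating tableau (OT) of shape $\lambda$ and length $n$ is $O=(O_0,\dots,O_n)$ with $O_0=\emptyset$, $O_n=\lambda$, and for each $j\in[n]$ either $O_{j-1}\lhd O_j$ ($j$ an addition) or $O_j\lhd O_{j-1}$ ($j$ a deletion); $B_j$ is the box where $O_{j-1},O_j$ differ;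 $\mathrm{OT}_n(\lambda)$ is the set of these. Descent composition: split $\{1,\dots,n\}$ into consecutive blocks, where $1$ starts a block and, for $2\le j\le n$, $j$ is in the same block as $j-1$ iff (a) $j-1,j$ are both additions and $B_{j-1}<_{nE}B_j$, or (b) both are deletions and $B_j<_{nE}B_{j-1}$, or (c) $j-1$ is a deletion and $j$ an addition. $\mathrm{des}\,O$ is the sequence of block lengths. An SSOT of shape $\lambda$ is a sequence of partitions $S=(S^1,S'^2,S^2,S'^3,\dots)$ such that, with $S^0=S'^1=\emptyset$: for all $i\ge1$, $S'^i\subseteq S^{i-1}$, $S'^i\subseteq S^i$, and $S^{i-1}/S'^i$, $S^i/S'^i$ are horizontal strips (possibly empty); and $S^i=S'^{i+1}=\lambda$ for all large $i$. Put $m_i(S)=|S^{i-1}/S'^i|+|S^i/S'^i|$, length $n=\sum_im_i(S)$, $x^S=\prod_ix_i^{m_i(S)}$. $\mathrm{SSOT}_n(\lambda)$ is the set of SSOTs of shape $\lambda$ and length $n$, and $\mathrm{ss}_{\lambda,n}(x)=\sum_{S\in\mathrm{SSOT}_n(\lambda)}x^S$. -}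

module Defs where

open import Data.Nat using (ℕ; zero; suc; _+_; _∸_; _≤_; _<_; _≥_; _<ᵇ_; _≤ᵇ_; _≡ᵇ_)
open import Data.Bool using (Bool; true; false; _∧_; _∨_; not; if_then_else_; T)
open import Data.List using (List; []; _∷_; concat; length)
open import Data.Nat.ListAction using (sum)
open import Data.List.Relation.Unary.All using (All)
open import Data.List.Relation.Unary.Linked using (Linked)
open import Data.List.Relation.Binary.Pointwise using (Pointwise)
open import Data.Vec using (Vec; lookup; toList)
open import Data.Fin using (Fin; inject₁; fromℕ) renaming (zero to fzero; suc to fsuc)
open import Data.Product using (Σ; ∃; _×_; _,_; proj₁)
open import Data.Sum using (_⊎_)
open import Data.Empty using (⊥)
open import Relation.Binary.PropositionalEquality using (_≡_; refl; sym; trans)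
open import Relation.Binary.Bundles using (Setoid)
open import Level using (0ℓ)

-- Partitions: a partition is a list of positive, weakly decreasing parts
-- (so no trailing zeros; equality of partitions is equality of lists).
-- Rows and columns of boxes are indexed from 0 (only comparisons matter).

IsPartition : List ℕ → Set
IsPartition l = All (λ x → 0 < x) l × Linked _≥_ l

row : List ℕ → ℕ → ℕ
row []       _       = 0
row (x ∷ _)  zero    = x
row (_ ∷ xs) (suc i) = row xs i

size : List ℕ → ℕ
size = sum

InDiagram : List ℕ → ℕ → ℕ → Set
InDiagram l i j = j < row l i

_⊆ₚ_ : List ℕ → List ℕ → Set
μ ⊆ₚ λ' = ∀ i j → InDiagram μ i j → InDiagram λ' i j

InSkew : List ℕ → List ℕ → ℕ → ℕ → Set
InSkew λ' μ i j = InDiagram λ' i j × (InDiagram μ i j → ⊥)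

HorizontalStrip : List ℕ → List ℕ → Set
HorizontalStrip λ' μ = ∀ i i' j → i < i' → InSkew λ' μ i j → InSkew λ' μ i' j → ⊥

_◁_ : List ℕ → List ℕ → Set
ν ◁ μ = ν ⊆ₚ μ × size μ ≡ suc (size ν)

InN : List ℕ → ℕ → Set
InN λ' n = size λ' ≤ n × Σ ℕ (λ k → n ≡ size λ' + (k + k))

-- coefficient c_i of a weak composition (i ≥ 1), trailing zeros implicit
wpart : List ℕ → ℕ → ℕ
wpart c zero    = 0
wpart c (suc i) = row c i

flat : List ℕ → List ℕ
flat []            = []
flat (zero ∷ c)    = flat c
flat (suc k ∷ c)   = suc k ∷ flat c

InRef : List ℕ → List ℕ → Set
InRef b a = Σ (List (List ℕ)) λ bs →
  Pointwise (λ piece aj → All (λ x → 0 < x) piece × sum piece ≡ aj) bs a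
  × concat bs ≡ b

-- Semistandard oscillating tableaux.
-- S i      represents S^i   (i ≥ 0, S^0 = ∅)
-- S′ i     represents S'^(i+1) (i ≥ 0, S'^1 = ∅)

record SSOT (λ' : List ℕ) : Set where
  field
    S      : ℕ → List ℕ
    S′     : ℕ → List ℕ
    S-part  : ∀ i → IsPartition (S i)
    S′-part : ∀ i → IsPartition (S′ i)
    S-zero  : S 0 ≡ []
    S′-zero : S′ 0 ≡ []
    sub-prev : ∀ k → S′ k ⊆ₚ S k
    sub-next : ∀ k → S′ k ⊆ₚ S (suc k)
    hs-prev  : ∀ k → HorizontalStrip (S k) (S′ k)
    hs-next  : ∀ k → HorizontalStrip (S (suc k)) (S′ k)
    eventually : Σ ℕ λ N → ∀ i → N ≤ i → S i ≡ λ' × S′ i ≡ λ'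

open SSOT public

mult : ∀ {λ'} → SSOT λ' → ℕ → ℕ
mult T zero    = 0
mult T (suc k) = (size (S T k) ∸ size (S′ T k)) + (size (S T (suc k)) ∸ size (S′ T k))

-- SSOTs of shape λ with x^S = x^c and length n.
-- (When x^S = x^c the length Σ m_i(S) equals sum c.)
SSOTWeight : List ℕ → ℕ → List ℕ → Set
SSOTWeight λ' n c = Σ (SSOT λ') λ T → (∀ i → mult T i ≡ wpart c i) × sum c ≡ n

SSOTWeightSetoid : List ℕ → ℕ → List ℕ → Setoid 0ℓ 0ℓ
SSOTWeightSetoid λ' n c = record
  { Carrier = SSOTWeight λ' n c
  ; _≈_ = λ A B → ∀ i → S (proj₁ A) i ≡ S (proj₁ B) i × S′ (proj₁ A) i ≡ S′ (proj₁ B) i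
  ; isEquivalence = record
    { refl  = λ i → refl , refl
    ; sym   = λ p i → sym (Data.Product.proj₁ (p i)) , sym (Data.Product.proj₂ (p i))
    ; trans = λ p q i → trans (Data.Product.proj₁ (p i)) (Data.Product.proj₁ (q i))
                      , trans (Data.Product.proj₂ (p i)) (Data.Product.proj₂ (q i))
    }
  }

record OT (n : ℕ) (λ' : List ℕ) : Set where
  field
    O      : Vec (List ℕ) (suc n)
    O-part : ∀ j → IsPartition (lookup O j)
    O-init : lookup O fzero ≡ []
    O-last : lookup O (fromℕ n) ≡ λ'
    O-step : ∀ (j : Fin n) → (lookup O (inject₁ j) ◁ lookup O (fsuc j))
                            ⊎ (lookup O (fsuc j) ◁ lookup O (inject₁ j))

open OT public

diffRow : List ℕ → List ℕ → ℕ
diffRow (a ∷ as) (b ∷ bs) = if a ≡ᵇ b then suc (diffRow as bs) else 0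
diffRow _        _        = 0

addedBox : List ℕ → List ℕ → ℕ × ℕ
addedBox ν μ = diffRow ν μ , row ν (diffRow ν μ)

record Step : Set where
  constructor step
  field
    isAdd : Bool
    box   : ℕ × ℕ

mkStep : List ℕ → List ℕ → Step
mkStep p q = if size p <ᵇ size q then step true (addedBox p q) else step false (addedBox q p)

steps : List (List ℕ) → List Step
steps (p ∷ q ∷ rest) = mkStep p q ∷ steps (q ∷ rest)
steps _              = []

nEᵇ : ℕ × ℕ → ℕ × ℕ → Bool
nEᵇ (i₁ , j₁) (i₂ , j₂) = (i₂ ≤ᵇ i₁) ∧ (j₁ <ᵇ j₂)

sameBlock : Step → Step → Bool
sameBlock (step a₁ b₁) (step a₂ b₂) =
  (a₁ ∧ a₂ ∧ nEᵇ b₁ b₂) ∨ (not a₁ ∧ not a₂ ∧ nEᵇ b₂ b₁) ∨ (not a₁ ∧ a₂)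

blocks : Step → ℕ → List Step → List ℕ
blocks prev k []       = k ∷ []
blocks prev k (t ∷ ts) = if sameBlock prev t then blocks t (suc k) ts else k ∷ blocks t 1 ts

desList : List Step → List ℕ
desList []       = []
desList (s ∷ ss) = blocks s 1 ss

des : ∀ {n λ'} → OT n λ' → List ℕ
des T = desList (steps (toList (O T)))

-- OTs O in OT_n(λ) with ♭(c) ∈ ref(des O), i.e. the coefficient of x^c
-- in Σ_O F_(des O)
OTWeight : List ℕ → ℕ → List ℕ → Set
OTWeight λ' n c = Σ (OT n λ') λ T → InRef (flat c) (des T)

OTWeightSetoid : List ℕ → ℕ → List ℕ → Setoid 0ℓ 0ℓ
OTWeightSetoid λ' n c = record
  { Carrier = OTWeight λ' n c
  ; _≈_ = λ A B → O (proj₁ A) ≡ O (proj₁ B)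
  ; isEquivalence = record { refl = refl ; sym = sym ; trans = trans }
  }

{-# OPTIONS --safe #-}
-- A horizontal strip can be filled one box at a time in exactly one way with rows weakly decreasing
-- (the boxes then run from left to right), and emptied in exactly one way with rows weakly increasing.
-- Replacing each S^(i-1) ⊇ S'^i ⊆ S^i by the emptying chain followed by the filling chain turns an SSOT
-- into an OT cut into runs of lengths m_i, and the descent rule is made so that consecutive steps of a
-- run lie in one block; hence ♭(c) refines des. Conversely, a run inside one block consists of
-- deletions followed by additions, so the endpoints of the runs and their lowest points give back the SSOT.

module Submission where

open import Defs
open import Data.Bool using (T; true; false; _∨_)
open import Data.Bool.Properties using (T-∧; ∨-identityʳ)
open import Data.Empty using (⊥; ⊥-elim)
open import Data.Fin using (fromℕ; inject₁) renaming (zero to fzero; suc to fsuc)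
open import Data.List using (List; []; _∷_; _++_; concat; drop; length)
open import Data.List.Properties using (++-assoc; ∷-injective; length-++)
open import Data.List.Relation.Binary.Pointwise using ([]; _∷_)
open import Data.List.Relation.Unary.All using (All; []; _∷_)
open import Data.List.Relation.Unary.All.Properties using (++⁺)
open import Data.List.Relation.Unary.Linked using (Linked; []; [-]; _∷_)
open import Data.Nat
open import Data.Nat.ListAction using (sum)
open import Data.Nat.ListAction.Properties using (sum-++)
open import Data.Nat.Properties
open import Data.Product using (Σ; ∃; _×_; _,_; proj₁; proj₂)
open import Data.Sum using (_⊎_; inj₁; inj₂)
open import Data.Unit using (tt)
open import Data.Vec using (Vec; []; _∷_; fromList; lookup; toList)
open import Data.Vec.Properties using (cast-is-id; length-toList; toList-injective; toList∘fromList)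
open import Function using (_∘_)
open import Function.Bundles using (Bijection; Equivalence)
open import Relation.Binary.Definitions using (tri<; tri≈; tri>)
open import Relation.Binary.PropositionalEquality
open import Relation.Nullary using (yes; no; contradiction)

-- Rows of a partition

-- The identity is proved one coefficient at a time: `F_(des O)` has coefficient 1 at `x^c` when
-- `flat c` refines `des O` and 0 otherwise, so each `c` calls for a bijection between `SSOTWeight`
-- and `OTWeight`. The two sides meet in `Dec c [] xs λ'`, a decomposition of the walk with vertices
-- `xs` along the parts of `c`. Its peaks and valleys determine `xs` (`dec-unique`), and `xs`
-- determines them (`dec-functional`); bijectivity rests on these two facts. The refinement
-- condition is the awkward one: `blocks` carries only a running count, and one block may hold
-- several runs. `Start` and `Cont` turn it into a condition on pairs of consecutive steps inside a
-- run. A zero part of `c` is an empty run, invisible to `flat` but present in the tableau.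

infix 4 _≼_

_≼_ : List ℕ → List ℕ → Set
ν ≼ μ = ∀ i → row ν i ≤ row μ i

row≤sum : ∀ l i → row l i ≤ sum l
row≤sum []      i       = z≤n
row≤sum (x ∷ l) zero    = m≤m+n x (sum l)
row≤sum (x ∷ l) (suc i) = ≤-trans (row≤sum l i) (m≤n+m (sum l) x)

sum-mono : ∀ k l → k ≼ l → sum k ≤ sum l
sum-mono []      l       k≼l = z≤n
sum-mono (x ∷ k) []      k≼l = +-mono-≤ (k≼l 0) (sum-mono k [] (k≼l ∘ suc))
sum-mono (x ∷ k) (y ∷ l) k≼l = +-mono-≤ (k≼l 0) (sum-mono k l (k≼l ∘ suc))

sum-cong : ∀ k l → (∀ i → row k i ≡ row l i) → sum k ≡ sum l
sum-cong k l eq = ≤-antisym (sum-mono k l (≤-reflexive ∘ eq)) (sum-mono l k (≤-reflexive ∘ sym ∘ eq))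

-- A row where `l` is strictly longer would make its sum strictly larger, since no other row can
-- compensate.
≼-rows-≡ : ∀ k l → k ≼ l → sum l ≤ sum k → ∀ i → row k i ≡ row l i
≼-rows-≡ []      l       k≼l l≤k i = sym (n≤0⇒n≡0 (≤-trans (row≤sum l i) l≤k))
≼-rows-≡ (x ∷ k) []      k≼l l≤k i = n≤0⇒n≡0 (k≼l i)
≼-rows-≡ (x ∷ k) (y ∷ l) k≼l l≤k zero    = ≤-antisym (k≼l 0) (+-cancelʳ-≤ (sum k) y x
  (≤-trans (+-monoʳ-≤ y (sum-mono k l (k≼l ∘ suc))) l≤k))
≼-rows-≡ (x ∷ k) (y ∷ l) k≼l l≤k (suc i) = ≼-rows-≡ k l (k≼l ∘ suc) (+-cancelˡ-≤ x (sum l) (sum k)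
  (≤-trans (+-monoˡ-≤ (sum l) (k≼l 0)) l≤k)) i

row-beyond : ∀ l {i} → length l ≤ i → row l i ≡ 0
row-beyond []      _         = refl
row-beyond (_ ∷ l) (s≤s l≤i) = row-beyond l l≤i

rows-injective : ∀ {k l} → All (0 <_) k → All (0 <_) l → (∀ i → row k i ≡ row l i) → k ≡ l
rows-injective []         []         eq = refl
rows-injective []         (0<y ∷ _)  eq = contradiction (eq 0) (<⇒≢ 0<y)
rows-injective (0<x ∷ _)  []         eq = contradiction (sym (eq 0)) (<⇒≢ 0<x)
rows-injective (_ ∷ 0<k)  (_ ∷ 0<l)  eq = cong₂ _∷_ (eq 0) (rows-injective 0<k 0<l (eq ∘ suc))

partition-≡ : ∀ {k l} → IsPartition k → IsPartition l → (∀ i → row k i ≡ row l i) → k ≡ l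
partition-≡ (0<k , _) (0<l , _) = rows-injective 0<k 0<l

linked⇒row-step : ∀ {l} → Linked _≥_ l → ∀ i → row l (suc i) ≤ row l i
linked⇒row-step []        i       = z≤n
linked⇒row-step [-]       i       = z≤n
linked⇒row-step (x≥y ∷ _) zero    = x≥y
linked⇒row-step (_ ∷ l↓)  (suc i) = linked⇒row-step l↓ i

row-step⇒linked : ∀ {l} → (∀ i → row l (suc i) ≤ row l i) → Linked _≥_ l
row-step⇒linked {[]}        l↓ = []
row-step⇒linked {x ∷ []}    l↓ = [-]
row-step⇒linked {x ∷ y ∷ l} l↓ = l↓ 0 ∷ row-step⇒linked (l↓ ∘ suc)

row-step : ∀ {l} → IsPartition l → ∀ i → row l (suc i) ≤ row l i
row-step (_ , l↓) = linked⇒row-step l↓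

antitone : ∀ {f : ℕ → ℕ} → (∀ i → f (suc i) ≤ f i) → ∀ {i j} → i ≤ j → f j ≤ f i
antitone f↓ {zero}  {zero}  _         = ≤-refl
antitone f↓ {zero}  {suc j} _         = ≤-trans (f↓ j) (antitone f↓ z≤n)
antitone f↓ {suc i} {suc j} (s≤s i≤j) = antitone (f↓ ∘ suc) i≤j

row-antitone : ∀ {l} → IsPartition l → ∀ {i j} → i ≤ j → row l j ≤ row l i
row-antitone = antitone ∘ row-step

-- Cutting off at the first zero keeps all parts positive; `n` bounds the number of rows inspected.
fromRows : ℕ → (ℕ → ℕ) → List ℕ
fromRows zero    f = []
fromRows (suc n) f with f 0
... | zero  = []
... | suc x = suc x ∷ fromRows n (f ∘ suc)

fromRows-positive : ∀ n f → All (0 <_) (fromRows n f)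
fromRows-positive zero    f = []
fromRows-positive (suc n) f with f 0
... | zero  = []
... | suc x = z<s ∷ fromRows-positive n (f ∘ suc)

row-fromRows : ∀ n {f} → (∀ i → f (suc i) ≤ f i) → f n ≡ 0 → ∀ i → row (fromRows n f) i ≡ f i
row-fromRows zero {f}    f↓ fn≡0 i = sym (n≤0⇒n≡0 (subst (f i ≤_) fn≡0 (antitone f↓ {0} {i} z≤n)))
row-fromRows (suc n) {f} f↓ fn≡0 i with f 0 in f0
row-fromRows (suc n) {f} f↓ fn≡0 i       | zero  = sym (n≤0⇒n≡0 (subst (f i ≤_) f0 (antitone f↓ {0} {i} z≤n)))
row-fromRows (suc n)     f↓ fn≡0 zero    | suc x = sym f0
row-fromRows (suc n)     f↓ fn≡0 (suc i) | suc x = row-fromRows n (f↓ ∘ suc) fn≡0 i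

_[_≔_] : (ℕ → ℕ) → ℕ → ℕ → ℕ → ℕ
(f [ i ≔ v ]) k with k ≟ i
... | yes _ = v
... | no  _ = f k

≔-same : ∀ f i v → (f [ i ≔ v ]) i ≡ v
≔-same f i v with i ≟ i
... | yes _   = refl
... | no  i≢i = contradiction refl i≢i

≔-other : ∀ f {i} v {k} → k ≢ i → (f [ i ≔ v ]) k ≡ f k
≔-other f {i} v {k} k≢i with k ≟ i
... | yes k≡i = contradiction k≡i k≢i
... | no  _   = refl

≔-antitone : ∀ {f i v} → (∀ k → f (suc k) ≤ f k) → f (suc i) ≤ v → (∀ {k} → suc k ≡ i → v ≤ f k) →
  ∀ k → (f [ i ≔ v ]) (suc k) ≤ (f [ i ≔ v ]) k
≔-antitone {f} {i} f↓ below above k with suc k ≟ i | k ≟ i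
... | yes refl | yes ()
... | yes k+1≡i | no _    = above k+1≡i
... | no _      | yes refl = below
... | no _      | no _    = f↓ k

-- Writing `above` with `suc k ≡ i` makes it vacuous for the first row, which has no row above it.
module _ {l i v} (l-part : IsPartition l) (below : row l (suc i) ≤ v) (above : ∀ {k} → suc k ≡ i → v ≤ row l k) where

  private
    bound : ℕ
    -- Past both `i` and the rows of `l`, so the updated row function vanishes there; `i` may itself
    -- lie beyond the last row of `l`.
    bound = suc (i + length l)

    new↓ : ∀ k → (row l [ i ≔ v ]) (suc k) ≤ (row l [ i ≔ v ]) k
    new↓ = ≔-antitone (row-step l-part) below above

    row-setRow : ∀ k → row (fromRows bound (row l [ i ≔ v ])) k ≡ (row l [ i ≔ v ]) k
    row-setRow = row-fromRows bound new↓
      (trans (≔-other (row l) v (≢-sym (<⇒≢ (s≤s (m≤m+n i (length l))))))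
             (row-beyond l (m≤n⇒m≤1+n (m≤n+m (length l) i))))

  setRow : List ℕ
  setRow = fromRows bound (row l [ i ≔ v ])

  setRow-part : IsPartition setRow
  setRow-part = fromRows-positive bound _ ,
    row-step⇒linked (λ k → subst₂ _≤_ (sym (row-setRow (suc k))) (sym (row-setRow k)) (new↓ k))

  row-setRow-same : row setRow i ≡ v
  row-setRow-same = trans (row-setRow i) (≔-same (row l) i v)

  row-setRow-other : ∀ {k} → k ≢ i → row setRow k ≡ row l k
  row-setRow-other {k} k≢i = trans (row-setRow k) (≔-other (row l) v k≢i)

-- Adding a box

-- The row alone identifies the box: its column is `row ν i`.
record Add (i : ℕ) (ν μ : List ℕ) : Set where
  field
    source : IsPartition ν
    target : IsPartition μ
    grown  : row μ i ≡ suc (row ν i)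
    kept   : ∀ {k} → k ≢ i → row μ k ≡ row ν k

open Add

add-≼ : ∀ {i ν μ} → Add i ν μ → ν ≼ μ
add-≼ {i} {ν} A k with k ≟ i
... | yes refl = subst (row ν k ≤_) (sym (grown A)) (n≤1+n _)
... | no  k≢i  = ≤-reflexive (sym (kept A k≢i))

add-row-unique : ∀ {i i' ν μ} → Add i ν μ → Add i' ν μ → i ≡ i'
add-row-unique {i} {i'} A A' with i ≟ i'
... | yes i≡i' = i≡i'
... | no  i≢i' = contradiction (trans (sym (kept A' i≢i')) (grown A)) (<⇒≢ (n<1+n _))

add-functional : ∀ {i ν μ μ'} → Add i ν μ → Add i ν μ' → μ ≡ μ'
add-functional {i} A A' = partition-≡ (target A) (target A') rows
  where
  rows : ∀ k → _
  rows k with k ≟ i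
  ... | yes refl = trans (grown A) (sym (grown A'))
  ... | no  k≢i  = trans (kept A k≢i) (sym (kept A' k≢i))

add-injective : ∀ {i ν ν' μ} → Add i ν μ → Add i ν' μ → ν ≡ ν'
add-injective {i} A A' = partition-≡ (source A) (source A') rows
  where
  rows : ∀ k → _
  rows k with k ≟ i
  ... | yes refl = suc-injective (trans (sym (grown A)) (grown A'))
  ... | no  k≢i  = trans (sym (kept A k≢i)) (kept A' k≢i)

row-drop1 : ∀ l i → row (drop 1 l) i ≡ row l (suc i)
row-drop1 []      i = refl
row-drop1 (_ ∷ l) i = refl

sum-drop1 : ∀ l → sum l ≡ row l 0 + sum (drop 1 l)
sum-drop1 []      = refl
sum-drop1 (_ ∷ l) = refl

-- `drop 1` replaces matching on the lists because `μ` may have one row more than `ν`; a missing row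
-- then counts as 0 on both sides.
sum-suc : ∀ i ν μ → row μ i ≡ suc (row ν i) → (∀ {k} → k ≢ i → row μ k ≡ row ν k) → sum μ ≡ suc (sum ν)
sum-suc zero ν μ g k = begin
  sum μ                           ≡⟨ sum-drop1 μ ⟩
  row μ 0 + sum (drop 1 μ)        ≡⟨ cong₂ _+_ g (sum-cong (drop 1 μ) (drop 1 ν) λ j →
                                       trans (row-drop1 μ j) (trans (k λ ()) (sym (row-drop1 ν j)))) ⟩
  suc (row ν 0) + sum (drop 1 ν)  ≡⟨ cong suc (sum-drop1 ν) ⟨
  suc (sum ν)                     ∎
  where open ≡-Reasoning
sum-suc (suc i) ν μ g k = begin
  sum μ                           ≡⟨ sum-drop1 μ ⟩
  row μ 0 + sum (drop 1 μ)        ≡⟨ cong₂ _+_ (k λ ()) (sum-suc i (drop 1 ν) (drop 1 μ)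
                                       (trans (row-drop1 μ i) (trans g (cong suc (sym (row-drop1 ν i)))))
                                       λ {j} j≢i → trans (row-drop1 μ j)
                                         (trans (k (j≢i ∘ suc-injective)) (sym (row-drop1 ν j)))) ⟩
  row ν 0 + suc (sum (drop 1 ν))  ≡⟨ +-suc (row ν 0) _ ⟩
  suc (row ν 0 + sum (drop 1 ν))  ≡⟨ cong suc (sum-drop1 ν) ⟨
  suc (sum ν)                     ∎
  where open ≡-Reasoning

add-size : ∀ {i ν μ} → Add i ν μ → size μ ≡ suc (size ν)
add-size {i} {ν} {μ} A = sum-suc i ν μ (grown A) (kept A)

≼⇒⊆ₚ : ∀ ν μ → ν ≼ μ → ν ⊆ₚ μ
≼⇒⊆ₚ ν μ ν≼μ i j j<ν = <-≤-trans j<ν (ν≼μ i)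

⊆ₚ⇒≼ : ∀ ν μ → ν ⊆ₚ μ → ν ≼ μ
⊆ₚ⇒≼ ν μ ν⊆μ i with row ν i ≤? row μ i
... | yes ν≤μ = ν≤μ
... | no  ν≰μ = contradiction (ν⊆μ i (row μ i) (≰⇒> ν≰μ)) (n≮n _)

add⇒◁ : ∀ {i ν μ} → Add i ν μ → ν ◁ μ
add⇒◁ {ν = ν} {μ} A = ≼⇒⊆ₚ ν μ (add-≼ A) , add-size A

-- At the first row that differs `μ` is ahead by at least one, and the sizes differ by exactly one,
-- so nothing is left for later rows. When `ν` runs out, positivity of the parts of `μ` ensures that
-- the very next row is the one that grows.
grows-at-diffRow : ∀ ν μ → ν ≼ μ → All (0 <_) μ → sum μ ≡ suc (sum ν) →
  row μ (diffRow ν μ) ≡ suc (row ν (diffRow ν μ)) × (∀ {k} → k ≢ diffRow ν μ → row μ k ≡ row ν k)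
grows-at-diffRow [] (zero ∷ μ) ν≼μ (() ∷ _) eq
grows-at-diffRow [] (suc x ∷ μ) ν≼μ _ eq = cong suc (m+n≡0⇒m≡0 x sum≡0) , other
  where
  sum≡0 : x + sum μ ≡ 0
  sum≡0 = suc-injective eq
  other : ∀ {k} → k ≢ 0 → row (suc x ∷ μ) k ≡ 0
  other {zero}  0≢0 = contradiction refl 0≢0
  other {suc k} _   = n≤0⇒n≡0 (≤-trans (row≤sum μ k) (≤-reflexive (m+n≡0⇒n≡0 x sum≡0)))
grows-at-diffRow (a ∷ ν) (b ∷ μ) ν≼μ (_ ∷ 0<μ) eq with a ≡ᵇ b in a≡ᵇb
... | true = proj₁ rec , other
  where
  a≡b : a ≡ b
  a≡b = ≡ᵇ⇒≡ a b (subst T (sym a≡ᵇb) tt)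
  rec = grows-at-diffRow ν μ (ν≼μ ∘ suc) 0<μ
    (+-cancelˡ-≡ b _ _ (trans eq (trans (cong (λ x → suc (x + sum ν)) a≡b) (sym (+-suc b (sum ν))))))
  other : ∀ {k} → k ≢ suc (diffRow ν μ) → row (b ∷ μ) k ≡ row (a ∷ ν) k
  other {zero}  _   = sym a≡b
  other {suc k} k≢i = proj₂ rec (k≢i ∘ cong suc)
... | false = b≡1+a , other
  where
  a<b : a < b
  a<b = ≤∧≢⇒< (ν≼μ 0) (λ a≡b → subst T a≡ᵇb (≡⇒≡ᵇ a b a≡b))
  sumν≤sumμ : sum ν ≤ sum μ
  sumν≤sumμ = sum-mono ν μ (ν≼μ ∘ suc)
  b≡1+a : b ≡ suc a
  b≡1+a = ≤-antisym (+-cancelʳ-≤ (sum ν) b (suc a)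
    (≤-trans (+-monoʳ-≤ b sumν≤sumμ) (≤-reflexive eq))) a<b
  other : ∀ {k} → k ≢ 0 → row (b ∷ μ) k ≡ row (a ∷ ν) k
  other {zero}  0≢0 = contradiction refl 0≢0
  other {suc k} _   = sym (≼-rows-≡ ν μ (ν≼μ ∘ suc)
    (+-cancelˡ-≤ (suc a) _ _ (≤-trans (+-monoˡ-≤ (sum μ) a<b) (≤-reflexive eq))) k)

◁⇒add : ∀ {ν μ} → IsPartition ν → IsPartition μ → ν ◁ μ → Add (diffRow ν μ) ν μ
◁⇒add {ν} {μ} ν-part μ-part (ν⊆μ , sz) = record
  { source = ν-part ; target = μ-part ; grown = proj₁ g ; kept = proj₂ g }
  where g = grows-at-diffRow ν μ (⊆ₚ⇒≼ ν μ ν⊆μ) (proj₁ μ-part) sz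

add-diffRow : ∀ {i ν μ} → Add i ν μ → diffRow ν μ ≡ i
add-diffRow A = add-row-unique (◁⇒add (source A) (target A) (add⇒◁ A)) A

mkStep-add : ∀ {i ν μ} → Add i ν μ → mkStep ν μ ≡ step true (i , row ν i)
mkStep-add {i} {ν} {μ} A with size ν <ᵇ size μ in lt
... | true  rewrite add-diffRow A = refl
... | false = ⊥-elim (subst T lt (<⇒<ᵇ (≤-reflexive (sym (add-size A)))))

mkStep-del : ∀ {i ν μ} → Add i ν μ → mkStep μ ν ≡ step false (i , row ν i)
mkStep-del {i} {ν} {μ} A with size μ <ᵇ size ν in lt
... | false rewrite add-diffRow A = refl
... | true  = contradiction (<ᵇ⇒< (size μ) (size ν) (subst T (sym lt) tt))
                            (<-asym (≤-reflexive (sym (add-size A))))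

-- Chains filling and emptying a horizontal strip


-- The list omits the first shape and includes the last, so that successive chains are joined by
-- `++`. The bound passed on is the row of the box just treated: an upper bound for additions, a
-- lower one for deletions.
data Up (b : ℕ) (ν : List ℕ) : List (List ℕ) → List ℕ → Set where
  []  : Up b ν [] ν
  add : ∀ {i μ as q} → i ≤ b → Add i ν μ → Up i μ as q → Up b ν (μ ∷ as) q

data Down (a : ℕ) (p : List ℕ) : List (List ℕ) → List ℕ → Set where
  []  : Down a p [] p
  del : ∀ {i μ ds ν} → a ≤ i → Add i μ p → Down i μ ds ν → Down a p (μ ∷ ds) ν

up-weaken : ∀ {b b' ν as q} → b ≤ b' → Up b ν as q → Up b' ν as q
up-weaken b≤b' []            = []
up-weaken b≤b' (add i≤b A u) = add (≤-trans i≤b b≤b') A u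

down-weaken : ∀ {a a' p ds ν} → a' ≤ a → Down a p ds ν → Down a' p ds ν
down-weaken a'≤a []            = []
down-weaken a'≤a (del a≤i A d) = del (≤-trans a'≤a a≤i) A d

up-size : ∀ {b ν as q} → Up b ν as q → size q ≡ length as + size ν
up-size [] = refl
up-size {as = _ ∷ as} (add _ A u) = trans (up-size u) (trans (cong (length as +_) (add-size A)) (+-suc (length as) _))

down-size : ∀ {a p ds ν} → Down a p ds ν → size p ≡ length ds + size ν
down-size []          = refl
down-size (del _ A d) = trans (add-size A) (cong suc (down-size d))

up-≼ : ∀ {b ν as q} → Up b ν as q → ν ≼ q
up-≼ []          i = ≤-refl
up-≼ (add _ A u) i = ≤-trans (add-≼ A i) (up-≼ u i)

down-≼ : ∀ {a p ds ν} → Down a p ds ν → ν ≼ p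
down-≼ []          i = ≤-refl
down-≼ (del _ A d) i = ≤-trans (down-≼ d i) (add-≼ A i)

up-above : ∀ {b ν as q} → Up b ν as q → ∀ {k} → b < k → row q k ≡ row ν k
up-above []            b<k = refl
up-above (add i≤b A u) b<k = trans (up-above u i<k) (kept A (≢-sym (<⇒≢ i<k)))
  where i<k = ≤-<-trans i≤b b<k

down-below : ∀ {a p ds ν} → Down a p ds ν → ∀ {k} → k < a → row p k ≡ row ν k
down-below []            k<a = refl
down-below (del a≤i A d) k<a = trans (kept A (<⇒≢ k<i)) (down-below d k<i)
  where k<i = <-≤-trans k<a a≤i

up-part : ∀ {b ν as q} → IsPartition ν → Up b ν as q → IsPartition q
up-part ν-part []          = ν-part
up-part ν-part (add _ A u) = up-part (target A) u

down-part : ∀ {a p ds ν} → IsPartition p → Down a p ds ν → IsPartition ν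
down-part p-part []          = p-part
down-part p-part (del _ A d) = down-part (source A) d

-- The interlacing form of the horizontal strip condition: it compares two numbers per row and is
-- what the inductions on chains can carry.
Strip : List ℕ → List ℕ → Set
Strip q ν = ∀ i → row q (suc i) ≤ row ν i

-- When a box enters row `k`, all later boxes have row at most `k`, so row `suc k` already has its
-- final length, which is still that of `ν`.
up-strip : ∀ {b ν as q} → IsPartition ν → Up b ν as q → Strip q ν
up-strip         ν-part []                  k = row-step ν-part k
up-strip {ν = ν} ν-part (add {i} {μ} _ A u) k with k ≟ i
... | yes refl = ≤-trans (≤-reflexive (trans (up-above u (n<1+n k)) (kept A 1+n≢n))) (row-step ν-part k)
... | no  k≢i  = ≤-trans (up-strip (target A) u k) (≤-reflexive (kept A k≢i))

-- When a box leaves row `suc k`, no later deletion reaches row `k`, so row `k` of `p` already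
-- equals that of `ν`.
down-strip : ∀ {a p ds ν} → IsPartition p → Down a p ds ν → Strip p ν
down-strip p-part []                  k = row-step p-part k
down-strip p-part (del {i} {μ} _ A d) k with suc k ≟ i
... | yes refl = ≤-trans (row-step p-part k) (≤-reflexive (trans (kept A (≢-sym 1+n≢n)) (down-below d (n<1+n k))))
... | no  k≢i  = ≤-trans (≤-reflexive (kept A k≢i)) (down-strip (source A) d k)

-- The first box must lie in the largest row where `ν` and `q` differ: a chain starting in row `i`
-- leaves all larger rows alone, while a chain starting in a larger row lengthens it for good.
up-unique : ∀ {b b' ν as as' q} → Up b ν as q → Up b' ν as' q → as ≡ as'
up-unique [] [] = refl
up-unique [] (add _ A u) = contradiction (up-≼ u _) (<⇒≱ (≤-reflexive (sym (grown A))))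
up-unique (add _ A u) [] = contradiction (up-≼ u _) (<⇒≱ (≤-reflexive (sym (grown A))))
up-unique {ν = ν} {q = q} (add {i} _ A u) (add {i'} _ A' u') = step≡
  where
  no-later : ∀ {i i' μ μ' as as'} → Add i ν μ → Up i μ as q → Add i' ν μ' → Up i' μ' as' q → i' ≤ i
  no-later {i} {i'} A u A' u' with i' ≤? i
  ... | yes i'≤i = i'≤i
  ... | no  i'≰i = contradiction
    (≤-trans (up-≼ u' i') (≤-reflexive (trans (up-above u (≰⇒> i'≰i)) (kept A (≢-sym (<⇒≢ (≰⇒> i'≰i)))))))
    (<⇒≱ (≤-reflexive (sym (grown A'))))
  step≡ : _
  step≡ with ≤-antisym (no-later A u A' u') (no-later A' u' A u)
  ... | refl with add-functional A A'
  ... | refl = cong (_ ∷_) (up-unique u u')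

down-unique : ∀ {a a' p ds ds' ν} → Down a p ds ν → Down a' p ds' ν → ds ≡ ds'
down-unique [] [] = refl
down-unique [] (del _ A d) = contradiction (down-≼ d _) (<⇒≱ (≤-reflexive (sym (grown A))))
down-unique (del _ A d) [] = contradiction (down-≼ d _) (<⇒≱ (≤-reflexive (sym (grown A))))
down-unique {p = p} {ν = ν} (del {i} _ A d) (del {i'} _ A' d') = step≡
  where
  no-earlier : ∀ {i i' μ μ' ds ds'} → Add i μ p → Down i μ ds ν → Add i' μ' p → Down i' μ' ds' ν → i ≤ i'
  no-earlier {i} {i'} A d A' d' with i ≤? i'
  ... | yes i≤i' = i≤i'
  ... | no  i≰i' = contradiction
    (≤-trans (≤-reflexive (trans (kept A (<⇒≢ (≰⇒> i≰i'))) (down-below d (≰⇒> i≰i')))) (down-≼ d' i'))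
    (<⇒≱ (≤-reflexive (sym (grown A'))))
  step≡ : _
  step≡ with ≤-antisym (no-earlier A' d' A d) (no-earlier A d A' d')
  ... | refl with add-injective A A'
  ... | refl = cong (_ ∷_) (down-unique d d')

-- Rows are filled from the largest index down; `b` is the current row and `d` the number of boxes
-- it still lacks. Each box fits because row `b` stays within that of `q`, which by the strip
-- condition is at most the preceding row of `ν`.
up-exists : ∀ b d {ν q} → IsPartition ν → IsPartition q → ν ≼ q → Strip q ν →
  (∀ {k} → b < k → row q k ≡ row ν k) → row q b ≡ d + row ν b → ∃ λ as → Up b ν as q
up-exists zero zero {ν} {q} ν-part q-part ν≼q strip above at =
  [] , subst (Up 0 ν []) (partition-≡ ν-part q-part rows) []
  where
  rows : ∀ k → row ν k ≡ row q k
  rows zero    = sym at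
  rows (suc k) = sym (above z<s)
up-exists (suc b) zero {ν} {q} ν-part q-part ν≼q strip above at =
  let as , u = up-exists b (row q b ∸ row ν b) ν-part q-part ν≼q strip above' (sym (m∸n+n≡m (ν≼q b)))
  in as , up-weaken (n≤1+n b) u
  where
  above' : ∀ {k} → b < k → row q k ≡ row ν k
  above' b<k with m≤n⇒m<n∨m≡n b<k
  ... | inj₁ 1+b<k = above 1+b<k
  ... | inj₂ refl  = at
up-exists b (suc d) {ν} {q} ν-part q-part ν≼q strip above at =
  let as , u = up-exists b d (target A) q-part μ≼q (λ k → ≤-trans (strip k) (add-≼ A k))
                 (λ b<k → trans (above b<k) (sym (kept A (≢-sym (<⇒≢ b<k)))))
                 (trans at (trans (sym (+-suc d _)) (cong (d +_) (sym (grown A)))))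
  in _ , add ≤-refl A u
  where
  ν<q : row ν b < row q b
  ν<q = ≤-trans (s≤s (m≤n+m _ d)) (≤-reflexive (sym at))
  below : row ν (suc b) ≤ suc (row ν b)
  below = m≤n⇒m≤1+n (row-step ν-part b)
  room : ∀ {k} → suc k ≡ b → suc (row ν b) ≤ row ν k
  room {k} refl = ≤-trans ν<q (strip k)
  A : Add b ν (setRow ν-part below room)
  A = record
    { source = ν-part ; target = setRow-part ν-part below room
    ; grown = row-setRow-same ν-part below room ; kept = row-setRow-other ν-part below room }
  μ≼q : setRow ν-part below room ≼ q
  μ≼q k with k ≟ b
  ... | yes refl = ≤-trans (≤-reflexive (grown A)) ν<q
  ... | no  k≢b  = ≤-trans (≤-reflexive (kept A k≢b)) (ν≼q k)

-- Rows are emptied in increasing order; `a` is the current row, `d` the number of boxes still to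
-- go, and `e` counts the rows left, since `a` itself grows. Row `a` never drops below that of `ν`,
-- which by the strip condition is at least row `suc a` of `p`.
down-exists : ∀ e a d {p ν} → IsPartition p → IsPartition ν → ν ≼ p → Strip p ν →
  (∀ {k} → k < a → row p k ≡ row ν k) → row p a ≡ d + row ν a → (∀ {k} → e + a < k → row p k ≡ 0) →
  ∃ λ ds → Down a p ds ν
down-exists zero a zero {p} {ν} p-part ν-part ν≼p strip below at end =
  [] , subst (Down a p []) (partition-≡ p-part ν-part rows) []
  where
  rows : ∀ k → row p k ≡ row ν k
  rows k with <-cmp k a
  ... | tri< k<a _ _  = below k<a
  ... | tri≈ _ refl _ = at
  ... | tri> _ _ a<k  = trans (end a<k) (sym (n≤0⇒n≡0 (≤-trans (ν≼p k) (≤-reflexive (end a<k)))))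
down-exists (suc e) a zero {p} {ν} p-part ν-part ν≼p strip below at end =
  let ds , d = down-exists e (suc a) (row p (suc a) ∸ row ν (suc a)) p-part ν-part ν≼p strip below'
                 (sym (m∸n+n≡m (ν≼p (suc a)))) (λ {k} lt → end (subst (_< k) (+-suc e a) lt))
  in ds , down-weaken (n≤1+n a) d
  where
  below' : ∀ {k} → k < suc a → row p k ≡ row ν k
  below' (s≤s k≤a) with m≤n⇒m<n∨m≡n k≤a
  ... | inj₁ k<a  = below k<a
  ... | inj₂ refl = at
down-exists e a (suc d) {p} {ν} p-part ν-part ν≼p strip below at end =
  let ds , dn = down-exists e a d (source A) ν-part ν≼μ (λ k → ≤-trans (add-≼ A (suc k)) (strip k))
                 (λ k<a → trans (sym (kept A (<⇒≢ k<a))) (below k<a))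
                 (row-setRow-same p-part under room)
                 (λ {k} lt → n≤0⇒n≡0 (≤-trans (add-≼ A k) (≤-reflexive (end lt))))
  in _ , del ≤-refl A dn
  where
  under : row p (suc a) ≤ d + row ν a
  under = ≤-trans (strip a) (m≤n+m _ d)
  room : ∀ {k} → suc k ≡ a → d + row ν a ≤ row p k
  room {k} refl = ≤-trans (≤-trans (n≤1+n _) (≤-reflexive (sym at))) (row-step p-part k)
  A : Add a (setRow p-part under room) p
  A = record
    { source = setRow-part p-part under room ; target = p-part
    ; grown = trans at (cong suc (sym (row-setRow-same p-part under room)))
    ; kept = λ k≢a → sym (row-setRow-other p-part under room k≢a) }
  ν≼μ : ν ≼ setRow p-part under room
  ν≼μ k with k ≟ a
  ... | yes refl = ≤-trans (m≤n+m _ d) (≤-reflexive (sym (row-setRow-same p-part under room)))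
  ... | no  k≢a  = ≤-trans (ν≼p k) (≤-reflexive (kept A k≢a))

strip⇒up : ∀ {ν q} → IsPartition ν → IsPartition q → ν ≼ q → Strip q ν → ∃ λ as → Up (length q) ν as q
-- Row `length q` is empty in both shapes, hence a start with no box missing.
strip⇒up {ν} {q} ν-part q-part ν≼q strip = up-exists (length q) 0 ν-part q-part ν≼q strip
  (λ lt → trans (zero-row (<⇒≤ lt)) (sym (n≤0⇒n≡0 (≤-trans (ν≼q _) (≤-reflexive (zero-row (<⇒≤ lt)))))))
  (trans (zero-row ≤-refl) (sym (n≤0⇒n≡0 (≤-trans (ν≼q _) (≤-reflexive (zero-row ≤-refl))))))
  where
  zero-row : ∀ {k} → length q ≤ k → row q k ≡ 0
  zero-row = row-beyond q

strip⇒down : ∀ {p ν} → IsPartition p → IsPartition ν → ν ≼ p → Strip p ν → ∃ λ ds → Down 0 p ds ν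
strip⇒down {p} {ν} p-part ν-part ν≼p strip = down-exists (length p) 0 (row p 0 ∸ row ν 0) p-part ν-part ν≼p strip
  (λ ()) (sym (m∸n+n≡m (ν≼p 0))) (λ lt → row-beyond p (≤-trans (m≤m+n _ 0) (<⇒≤ lt)))

strip⇒horizontal : ∀ {q ν} → IsPartition q → Strip q ν → HorizontalStrip q ν
strip⇒horizontal q-part strip i i' j i<i' (_ , j≮ν) (j<q , _) =
  j≮ν (<-≤-trans j<q (≤-trans (row-antitone q-part i<i') (strip i)))

horizontal⇒strip : ∀ {q ν} → IsPartition q → IsPartition ν → HorizontalStrip q ν → Strip q ν
horizontal⇒strip {q} {ν} q-part ν-part hs i with row q (suc i) ≤? row ν i
... | yes q≤ν = q≤ν
-- The column just past the end of row `i` of `ν` would hold two boxes of the strip, in rows `i` and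
-- `suc i`.
... | no  q≰ν = ⊥-elim (hs i (suc i) (row ν i) (n<1+n i)
  (<-≤-trans (≰⇒> q≰ν) (row-step q-part i) , n≮n _)
  (≰⇒> q≰ν , λ lt → contradiction (row-step ν-part i) (<⇒≱ lt)))

-- Cutting a list of steps into blocks of prescribed lengths

-- Start c ts says that ts can be cut into runs of lengths c, any two consecutive steps of a run
-- lying in the same descent block; in Cont j c s ts the current run has reached s and needs
-- j further steps.
mutual
  data Start : List ℕ → List Step → Set where
    []   : Start [] []
    skip : ∀ {c ts} → Start c ts → Start (0 ∷ c) ts
    new  : ∀ {j c t ts} → Cont j c t ts → Start (suc j ∷ c) (t ∷ ts)

  data Cont : ℕ → List ℕ → Step → List Step → Set where
    end  : ∀ {c s ts} → Start c ts → Cont 0 c s ts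
    more : ∀ {j c s t ts} → T (sameBlock s t) → Cont j c t ts → Cont (suc j) c s (t ∷ ts)

mutual
  start-flat : ∀ {c ts} → Start c ts → Start (flat c) ts
  start-flat []       = []
  start-flat (skip s) = start-flat s
  start-flat (new k)  = new (cont-flat k)

  cont-flat : ∀ {j c s ts} → Cont j c s ts → Cont j (flat c) s ts
  cont-flat (end s)       = end (start-flat s)
  cont-flat (more same k) = more same (cont-flat k)

mutual
  start-unflat : ∀ c {ts} → Start (flat c) ts → Start c ts
  start-unflat []          s       = s
  start-unflat (zero ∷ c)  s       = skip (start-unflat c s)
  start-unflat (suc j ∷ c) (new k) = new (cont-unflat c k)

  cont-unflat : ∀ c {j s ts} → Cont j (flat c) s ts → Cont j c s ts
  cont-unflat c (end s)       = end (start-unflat c s)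
  cont-unflat c (more same k) = more same (cont-unflat c k)

flat-positive : ∀ c → All (0 <_) (flat c)
flat-positive []          = []
flat-positive (zero ∷ c)  = flat-positive c
flat-positive (suc k ∷ c) = z<s ∷ flat-positive c

positive-sum-zero : ∀ {l} → All (0 <_) l → sum l ≡ 0 → l ≡ []
positive-sum-zero {[]}        _        _  = refl
positive-sum-zero {zero ∷ l}  (() ∷ _) _

ref-cons : ∀ {p b a k} → All (0 <_) p → sum p ≡ k → InRef b a → InRef (p ++ b) (k ∷ a)
ref-cons {p} 0<p sum≡k (bs , pw , eq) = p ∷ bs , (0<p , sum≡k) ∷ pw , cong (p ++_) eq

ref-positive : ∀ {b a} → InRef b a → All (0 <_) b
ref-positive (_ , [] , refl)              = []
ref-positive (_ , (0<p , _) ∷ pw , refl) = ++⁺ 0<p (ref-positive (_ , pw , refl))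

ref-sum : ∀ {b a} → InRef b a → sum b ≡ sum a
ref-sum (_ , [] , refl) = refl
ref-sum (p ∷ bs , (_ , sum≡k) ∷ pw , refl) =
  trans (sum-++ p (concat bs)) (cong₂ _+_ sum≡k (ref-sum (_ , pw , refl)))

sum-blocks : ∀ s k ts → sum (blocks s k ts) ≡ k + length ts
sum-blocks s k []       = refl
sum-blocks s k (t ∷ ts) with sameBlock s t
... | true  = trans (sum-blocks t (suc k) ts) (sym (+-suc k _))
... | false = cong (k +_) (sum-blocks t 1 ts)

-- `suc i + 0` is what the part `suc i + j` becomes when its run is complete.
sum-snoc : ∀ ps i → sum (ps ++ (suc i + 0) ∷ []) ≡ sum ps + suc i
sum-snoc ps i = trans (sum-++ ps _) (cong (sum ps +_) (trans (+-identityʳ _) (+-identityʳ (suc i))))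

sum-snoc-suc : ∀ ps i → sum (ps ++ (suc i + 0) ∷ []) + 1 ≡ suc (sum ps + suc i)
sum-snoc-suc ps i = trans (+-comm _ 1) (cong suc (sum-snoc ps i))

-- The current descent block consists of complete runs of lengths ps followed by 1 + i steps of
-- the run in progress.
cont⇒ref : ∀ ps i {j b s ts} → All (0 <_) ps → All (0 <_) b → Cont j b s ts →
  InRef (ps ++ (suc i + j) ∷ b) (blocks s (sum ps + suc i) ts)
cont⇒ref ps i 0<ps _ (end []) =
  (ps ++ (suc i + 0) ∷ []) ∷ [] , (++⁺ 0<ps (z<s ∷ []) , sum-snoc ps i) ∷ [] , ++-assoc ps _ []
cont⇒ref ps i 0<ps (() ∷ _) (end (skip _))
cont⇒ref ps i {s = s} {ts = t ∷ ts} 0<ps (_ ∷ 0<b) (end (new {j} {c} k)) with sameBlock s t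
-- The run ends but the block goes on: the run joins `ps`. In the other case the block closes too,
-- and the collected runs form one piece of the refinement.
... | true  = subst₂ InRef (++-assoc ps _ _) (cong (λ m → blocks t m ts) (sum-snoc-suc ps i))
                (cont⇒ref (ps ++ (suc i + 0) ∷ []) 0 (++⁺ 0<ps (z<s ∷ [])) 0<b k)
... | false = subst (λ b → InRef b _) (++-assoc ps _ _)
                (ref-cons (++⁺ 0<ps (z<s ∷ [])) (sum-snoc ps i) (cont⇒ref [] 0 [] 0<b k))
cont⇒ref ps i {b = b} {s} {t ∷ ts} 0<ps 0<b (more {j} same k) with sameBlock s t
... | true = subst₂ InRef (cong (λ m → ps ++ m ∷ b) (sym (+-suc (suc i) j)))
               (cong (λ m → blocks t m ts) (+-suc (sum ps) (suc i)))
               (cont⇒ref ps (suc i) 0<ps 0<b k)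

-- A block can close only where a run does. The piece `q` runs through `ps` and has `suc i` left
-- over for the next part, which is `suc i + j`; since `q` contains whole parts, `j` is 0 and `q`
-- stops there.
ref-split : ∀ {i j b r} q ps → All (0 <_) q → sum q ≡ sum ps + suc i → q ++ r ≡ ps ++ (suc i + j) ∷ b →
  j ≡ 0 × r ≡ b
ref-split {i} [] ps _ eq _ = contradiction (trans eq (+-suc (sum ps) i)) (λ ())
ref-split {i} {j} (x ∷ q) [] (_ ∷ 0<q) sum≡ eq with ∷-injective eq
... | refl , q++r≡b = m+n≡0⇒m≡0 j rest≡0 ,
  subst (λ q → q ++ _ ≡ _) (positive-sum-zero 0<q (m+n≡0⇒n≡0 j rest≡0)) q++r≡b
  where
  rest≡0 : j + sum q ≡ 0
  rest≡0 = +-cancelˡ-≡ (suc i) _ 0 (trans (sym (+-assoc (suc i) j (sum q))) (trans sum≡ (sym (+-identityʳ (suc i)))))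
ref-split (x ∷ q) (y ∷ ps) (_ ∷ 0<q) sum≡ eq with ∷-injective eq
... | refl , eq' = ref-split q ps 0<q (+-cancelˡ-≡ x _ _ (trans sum≡ (+-assoc x (sum ps) _))) eq'

ref-nonempty : ∀ {s k ts} → InRef [] (blocks s (suc k) ts) → ⊥
ref-nonempty {s} {k} {ts} r = contradiction (trans (ref-sum r) (sum-blocks s (suc k) ts)) (λ ())

drop-positive : ∀ ps {x b} → All (0 <_) (ps ++ x ∷ b) → All (0 <_) b
drop-positive []       (_ ∷ 0<b) = 0<b
drop-positive (_ ∷ ps) (_ ∷ 0<b) = drop-positive ps 0<b

-- The converse of `cont⇒ref`, one step at a time. While the block goes on, the step is charged to
-- the current run if that lacks steps and opens a new run otherwise; when the block closes,
-- `ref-split` shows that the run is complete.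
ref⇒cont : ∀ ps i {j b s} ts → InRef (ps ++ (suc i + j) ∷ b) (blocks s (sum ps + suc i) ts) → Cont j b s ts
ref⇒cont ps i {j} {b} {s} [] r = last-run
  where
  rest≡0 : j + sum b ≡ 0
  rest≡0 = +-cancelˡ-≡ (sum ps + suc i) _ 0 (begin
    sum ps + suc i + (j + sum b)    ≡⟨ +-assoc (sum ps) (suc i) _ ⟩
    sum ps + (suc i + (j + sum b))  ≡⟨ cong (sum ps +_) (+-assoc (suc i) j (sum b)) ⟨
    sum ps + (suc i + j + sum b)    ≡⟨ sum-++ ps _ ⟨
    sum (ps ++ (suc i + j) ∷ b)     ≡⟨ ref-sum r ⟩
    sum ps + suc i + 0              ∎)
    where open ≡-Reasoning
  last-run : Cont j b s []
  last-run with m+n≡0⇒m≡0 j rest≡0 | positive-sum-zero (drop-positive ps (ref-positive r)) (m+n≡0⇒n≡0 j rest≡0)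
  ... | refl | refl = end []
ref⇒cont ps i {j} {b} {s} (t ∷ ts) r with sameBlock s t in same
ref⇒cont ps i {suc j} {b} (t ∷ ts) r | true = more (subst T (sym same) tt)
  (ref⇒cont ps (suc i) ts (subst₂ InRef (cong (λ m → ps ++ m ∷ b) (+-suc (suc i) j))
    (cong (λ m → blocks t m ts) (sym (+-suc (sum ps) (suc i)))) r))
-- No part is left for `t`: the parts sum to less than the number of steps.
ref⇒cont ps i {zero} {[]} (t ∷ ts) r | true = contradiction
  (trans (sym (sum-snoc ps i)) (trans (ref-sum r) (sum-blocks t _ ts)))
  (<⇒≢ (m≤m+n _ (length ts)))
ref⇒cont ps i {zero} {x ∷ b} (t ∷ ts) r | true with drop-positive ps (ref-positive r)
ref⇒cont ps i {zero} {zero ∷ b} (t ∷ ts) r | true | () ∷ _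
ref⇒cont ps i {zero} {suc j ∷ b} (t ∷ ts) r | true | _ = end (new
  (ref⇒cont (ps ++ (suc i + 0) ∷ []) 0 ts
    (subst₂ InRef (sym (++-assoc ps _ _)) (cong (λ m → blocks t m ts) (sym (sum-snoc-suc ps i))) r)))
ref⇒cont ps i {j} {b} (t ∷ ts) (q ∷ bs , (0<q , sum≡) ∷ pw , eq) | false with ref-split q ps 0<q sum≡ eq
ref⇒cont ps i {zero} {[]} (t ∷ ts) (q ∷ bs , _ ∷ pw , eq) | false | refl , r≡b =
  ⊥-elim (ref-nonempty {t} {0} {ts} (bs , pw , r≡b))
ref⇒cont ps i {zero} {x ∷ b} (t ∷ ts) (q ∷ bs , _ ∷ pw , eq) | false | refl , r≡b with ref-positive (bs , pw , r≡b)
ref⇒cont ps i {zero} {zero ∷ b} (t ∷ ts) (q ∷ bs , _ ∷ pw , eq) | false | refl , r≡b | () ∷ _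
ref⇒cont ps i {zero} {suc j ∷ b} (t ∷ ts) (q ∷ bs , _ ∷ pw , eq) | false | refl , r≡b | _ =
  end (new (ref⇒cont [] 0 ts (bs , pw , r≡b)))

start⇒ref : ∀ {b ts} → All (0 <_) b → Start b ts → InRef b (desList ts)
start⇒ref _         []       = [] , [] , refl
start⇒ref (() ∷ _)  (skip _)
start⇒ref (_ ∷ 0<b) (new k)  = cont⇒ref [] 0 [] 0<b k

ref⇒start : ∀ {b} ts → InRef b (desList ts) → Start b ts
ref⇒start []       (_ , [] , refl) = []
ref⇒start {[]}    (t ∷ ts) r = ⊥-elim (ref-nonempty {t} {0} {ts} r)
ref⇒start {x ∷ b} (t ∷ ts) r with ref-positive r
ref⇒start {zero ∷ b} (t ∷ ts) r | () ∷ _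
ref⇒start {suc j ∷ b} (t ∷ ts) r | _ = new (ref⇒cont [] 0 ts r)

-- Oscillating walks and their decompositions

data Walk (p : List ℕ) : List (List ℕ) → List ℕ → Set where
  []   : Walk p [] p
  up   : ∀ {i x xs q} → Add i p x → Walk x xs q → Walk p (x ∷ xs) q
  down : ∀ {i x xs q} → Add i x p → Walk x xs q → Walk p (x ∷ xs) q

∨-false : ∀ {b} → T (b ∨ false) → T b
∨-false {b} = subst T (∨-identityʳ b)

false-∨ : ∀ {b} → T b → T (b ∨ false)
false-∨ {b} = subst T (sym (∨-identityʳ b))

nE-intro : ∀ {i₁ j₁ i₂ j₂} → i₂ ≤ i₁ → j₁ < j₂ → T (nEᵇ (i₁ , j₁) (i₂ , j₂))
nE-intro i₂≤i₁ j₁<j₂ = Equivalence.from T-∧ (≤⇒≤ᵇ i₂≤i₁ , <⇒<ᵇ j₁<j₂)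

nE-row : ∀ i₁ j₁ i₂ j₂ → T (nEᵇ (i₁ , j₁) (i₂ , j₂)) → i₂ ≤ i₁
nE-row i₁ j₁ i₂ j₂ t = ≤ᵇ⇒≤ i₂ i₁ (proj₁ (Equivalence.to (T-∧ {i₂ ≤ᵇ i₁}) t))

-- Along consecutive additions or deletions the column condition in <nE follows from the row condition.
same-add-add : ∀ {i i' p x y} → Add i p x → Add i' x y → i' ≤ i → T (sameBlock (mkStep p x) (mkStep x y))
same-add-add {i} {i'} {p} {x} A A' i'≤i rewrite mkStep-add A | mkStep-add A' = false-∨
  (nE-intro {i} {row p i} {i'} {row x i'} i'≤i
    (≤-trans (≤-reflexive (sym (grown A))) (row-antitone (target A) i'≤i)))

same-del-del : ∀ {i i' p x y} → Add i x p → Add i' y x → i ≤ i' → T (sameBlock (mkStep p x) (mkStep x y))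
same-del-del {i} {i'} {p} {x} {y} A A' i≤i' rewrite mkStep-del A | mkStep-del A' = false-∨
  (nE-intro {i'} {row y i'} {i} {row x i} i≤i'
    (≤-trans (≤-reflexive (sym (grown A'))) (row-antitone (source A) i≤i')))

same-del-add : ∀ {i i' p x y} → Add i x p → Add i' x y → T (sameBlock (mkStep p x) (mkStep x y))
same-del-add A A' rewrite mkStep-del A | mkStep-add A' = tt

same-add-add⁻¹ : ∀ {i i' p x y} → Add i p x → Add i' x y → T (sameBlock (mkStep p x) (mkStep x y)) → i' ≤ i
same-add-add⁻¹ {i} {i'} {p} {x} A A' t rewrite mkStep-add A | mkStep-add A' =
  nE-row i (row p i) i' (row x i') (∨-false t)

same-del-del⁻¹ : ∀ {i i' p x y} → Add i x p → Add i' y x → T (sameBlock (mkStep p x) (mkStep x y)) → i ≤ i'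
same-del-del⁻¹ {i} {i'} {p} {x} {y} A A' t rewrite mkStep-del A | mkStep-del A' =
  nE-row i' (row y i') i (row x i) (∨-false t)

¬same-add-del : ∀ {i i' p x y} → Add i p x → Add i' y x → T (sameBlock (mkStep p x) (mkStep x y)) → ⊥
¬same-add-del A A' t rewrite mkStep-add A | mkStep-del A' = t

-- xs lists the vertices after p of a walk to q; each part of c is a descending chain followed by an
-- ascending one.
data Dec : List ℕ → List ℕ → List (List ℕ) → List ℕ → Set where
  stop : ∀ {p q} → p ≡ q → Dec [] p [] q
  -- The bound 0 and the free `b` do not constrain the first box of either chain. The run length is
  -- an equation, not a sum in the index, so that two decompositions along the same `c` can be
  -- matched together.
  cut  : ∀ {m c p ν r q b ds as ys} → Down 0 p ds ν → Up b ν as r → m ≡ length ds + length as →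
         Dec c r ys q → Dec (m ∷ c) p (ds ++ as ++ ys) q

up-walk : ∀ {b ν as r ys q} → Up b ν as r → Walk r ys q → Walk ν (as ++ ys) q
up-walk []          w = w
up-walk (add _ A u) w = up A (up-walk u w)

down-walk : ∀ {a p ds ν ys q} → Down a p ds ν → Walk ν ys q → Walk p (ds ++ ys) q
down-walk []          w = w
down-walk (del _ A d) w = down A (down-walk d w)

dec⇒walk : ∀ {c p xs q} → Dec c p xs q → Walk p xs q
dec⇒walk (stop refl)   = []
dec⇒walk (cut d u _ D) = down-walk d (up-walk u (dec⇒walk D))

dec-length : ∀ {c p xs q} → Dec c p xs q → length xs ≡ sum c
dec-length (stop _) = refl
dec-length (cut {c = c} {ds = ds} {as} {ys} _ _ refl D) = begin
  length (ds ++ as ++ ys)               ≡⟨ length-++ ds ⟩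
  length ds + length (as ++ ys)         ≡⟨ cong (length ds +_) (length-++ as) ⟩
  length ds + (length as + length ys)   ≡⟨ +-assoc (length ds) _ _ ⟨
  length ds + length as + length ys     ≡⟨ cong (length ds + length as +_) (dec-length D) ⟩
  length ds + length as + sum c         ∎
  where open ≡-Reasoning

up⇒cont : ∀ {i p x as r c ys} → Add i p x → Up i x as r → Start c (steps (r ∷ ys)) →
  Cont (length as) c (mkStep p x) (steps (x ∷ as ++ ys))
up⇒cont A []               s = end s
up⇒cont A (add i'≤i A' u)  s = more (same-add-add A A' i'≤i) (up⇒cont A' u s)

down⇒cont : ∀ {i b p x ds ν as r c ys} → Add i x p → Down i x ds ν → Up b ν as r → Start c (steps (r ∷ ys)) →
  Cont (length ds + length as) c (mkStep p x) (steps (x ∷ ds ++ as ++ ys))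
down⇒cont A (del i≤i' A' d) u            s = more (same-del-del A A' i≤i') (down⇒cont A' d u s)
down⇒cont A []              []           s = end s
down⇒cont A []              (add _ A' u) s = more (same-del-add A A') (up⇒cont A' u s)

dec⇒start : ∀ {c p xs q} → Dec c p xs q → Start c (steps (p ∷ xs))
dec⇒start (stop _)                           = []
dec⇒start (cut (del _ A d) u           refl D) = new (down⇒cont A d u (dec⇒start D))
dec⇒start (cut []          (add _ A u) refl D) = new (up⇒cont A u (dec⇒start D))
dec⇒start (cut []          []          refl D) = skip (dec⇒start D)

-- Indexing by the length and the concatenation lets a match on `split` rewrite the step count and
-- the vertex list at once.
data UpSplit (i : ℕ) (x q : List ℕ) (c : List ℕ) : ℕ → List (List ℕ) → Set where
  split : ∀ {as r ys} → Up i x as r → Walk r ys q → Start c (steps (r ∷ ys)) →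
    UpSplit i x q c (length as) (as ++ ys)

data DownSplit (i : ℕ) (x q : List ℕ) (c : List ℕ) : ℕ → List (List ℕ) → Set where
  split : ∀ {b ds ν as r ys} → Down i x ds ν → Up b ν as r → Walk r ys q → Start c (steps (r ∷ ys)) →
    DownSplit i x q c (length ds + length as) (ds ++ as ++ ys)

cont⇒upSplit : ∀ {i p x xs q c j} → Add i p x → Walk x xs q → Cont j c (mkStep p x) (steps (x ∷ xs)) →
  UpSplit i x q c j xs
cont⇒upSplit {j = zero} A w           (end s)       = split [] w s
cont⇒upSplit {j = suc _} A (up A' w)   (more same k) with cont⇒upSplit A' w k
... | split u w' s = split (add (same-add-add⁻¹ A A' same) A' u) w' s
cont⇒upSplit {j = suc _} A (down A' w) (more same k) = ⊥-elim (¬same-add-del A A' same)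

cont⇒downSplit : ∀ {i p x xs q c j} → Add i x p → Walk x xs q → Cont j c (mkStep p x) (steps (x ∷ xs)) →
  DownSplit i x q c j xs
cont⇒downSplit {j = zero} A w           (end s)       = split {b = 0} [] [] w s
cont⇒downSplit {j = suc _} A (up A' w)   (more same k) with cont⇒upSplit A' w k
... | split u w' s = split [] (add ≤-refl A' u) w' s
cont⇒downSplit {j = suc _} A (down A' w) (more same k) with cont⇒downSplit A' w k
... | split d u w' s = split (del (same-del-del⁻¹ A A' same) A' d) u w' s

walk⇒dec : ∀ c {p xs q} → Walk p xs q → Start c (steps (p ∷ xs)) → Dec c p xs q
walk⇒dec []          []         s        = stop refl
walk⇒dec (zero ∷ c)  w          (skip s) = cut {b = 0} [] [] refl (walk⇒dec c w s)
walk⇒dec (suc j ∷ c) (up A w)   (new k)  with cont⇒upSplit A w k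
... | split u w' s = cut [] (add ≤-refl A u) refl (walk⇒dec c w' s)
walk⇒dec (suc j ∷ c) (down A w) (new k)  with cont⇒downSplit A w k
... | split d u w' s = cut (del z≤n A d) u refl (walk⇒dec c w' s)

-- Peaks and valleys: decompositions and semistandard oscillating tableaux

peak : ∀ {c p xs q} → Dec c p xs q → ℕ → List ℕ
peak {p = p} _             zero    = p
-- Past the last run both sequences are constant, as `eventually` requires; the default 0 of `row c`
-- is the matching weight.
peak {p = p} (stop _)      (suc k) = p
peak         (cut _ _ _ D) (suc k) = peak D k

valley : ∀ {c p xs q} → Dec c p xs q → ℕ → List ℕ
valley {p = p} (stop _)              k       = p
valley         (cut {ν = ν} _ _ _ D) zero    = ν
valley         (cut _ _ _ D)         (suc k) = valley D k

-- A dip is one step S^(i-1) ⊇ S'^i ⊆ S^i of a semistandard oscillating tableau.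
record Dip (p ν q : List ℕ) (m : ℕ) : Set where
  field
    p-part  : IsPartition p
    ν-part  : IsPartition ν
    q-part  : IsPartition q
    ν≼p     : ν ≼ p
    ν≼q     : ν ≼ q
    p-strip : Strip p ν
    q-strip : Strip q ν
    weight  : (size p ∸ size ν) + (size q ∸ size ν) ≡ m

open Dip

ssot⇒dip : ∀ {λ'} (τ : SSOT λ') k → Dip (S τ k) (S′ τ k) (S τ (suc k)) (mult τ (suc k))
ssot⇒dip τ k = record
  { p-part  = S-part τ k
  ; ν-part  = S′-part τ k
  ; q-part  = S-part τ (suc k)
  ; ν≼p     = ⊆ₚ⇒≼ (S′ τ k) (S τ k) (sub-prev τ k)
  ; ν≼q     = ⊆ₚ⇒≼ (S′ τ k) (S τ (suc k)) (sub-next τ k)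
  ; p-strip = horizontal⇒strip (S-part τ k) (S′-part τ k) (hs-prev τ k)
  ; q-strip = horizontal⇒strip (S-part τ (suc k)) (S′-part τ k) (hs-next τ k)
  ; weight  = refl
  }

chain-weight : ∀ {a b p ds ν as q} → Down a p ds ν → Up b ν as q →
  (size p ∸ size ν) + (size q ∸ size ν) ≡ length ds + length as
chain-weight {ds = ds} {ν} {as} d u = cong₂ _+_
  (trans (cong (_∸ size ν) (down-size d)) (m+n∸n≡m (length ds) (size ν)))
  (trans (cong (_∸ size ν) (up-size u)) (m+n∸n≡m (length as) (size ν)))

chains⇒dip : ∀ {a b p ds ν as q} → IsPartition p → Down a p ds ν → Up b ν as q →
  Dip p ν q (length ds + length as)
chains⇒dip p-part d u = record
  { p-part  = p-part
  ; ν-part  = down-part p-part d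
  ; q-part  = up-part (down-part p-part d) u
  ; ν≼p     = down-≼ d
  ; ν≼q     = up-≼ u
  ; p-strip = down-strip p-part d
  ; q-strip = up-strip (down-part p-part d) u
  ; weight  = chain-weight d u
  }

dec⇒dip : ∀ {c p xs q} → IsPartition p → (D : Dec c p xs q) → ∀ k →
  Dip (peak D k) (valley D k) (peak D (suc k)) (row c k)
dec⇒dip p-part (stop _)         zero    = chains⇒dip {0} {0} p-part [] []
dec⇒dip p-part (stop _)         (suc k) = chains⇒dip {0} {0} p-part [] []
dec⇒dip p-part (cut d u refl D) zero    = chains⇒dip p-part d u
dec⇒dip p-part (cut d u refl D) (suc k) = dec⇒dip (up-part (down-part p-part d) u) D k

dec-eventually : ∀ {c p xs q} (D : Dec c p xs q) → ∀ k → length c ≤ k → peak D k ≡ q × valley D k ≡ q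
dec-eventually (stop p≡q)    zero    _         = p≡q , p≡q
dec-eventually (stop p≡q)    (suc k) _         = p≡q , p≡q
dec-eventually (cut _ _ _ D) (suc k) (s≤s c≤k) = dec-eventually D k c≤k

dec⇒ssot : ∀ {c xs λ'} → Dec c [] xs λ' → SSOT λ'
dec⇒ssot {c} D = record
  { S          = peak D
  ; S′         = valley D
  ; S-part     = p-part ∘ dip
  ; S′-part    = ν-part ∘ dip
  ; S-zero     = refl
  ; S′-zero    = partition-≡ (ν-part (dip 0)) ([] , []) (λ i → n≤0⇒n≡0 (ν≼p (dip 0) i))
  ; sub-prev   = λ k → ≼⇒⊆ₚ (valley D k) (peak D k) (ν≼p (dip k))
  ; sub-next   = λ k → ≼⇒⊆ₚ (valley D k) (peak D (suc k)) (ν≼q (dip k))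
  ; hs-prev    = λ k → strip⇒horizontal {ν = valley D k} (p-part (dip k)) (p-strip (dip k))
  ; hs-next    = λ k → strip⇒horizontal {ν = valley D k} (q-part (dip k)) (q-strip (dip k))
  ; eventually = length c , dec-eventually D
  }
  where
  dip : ∀ k → Dip (peak D k) (valley D k) (peak D (suc k)) (row c k)
  dip = dec⇒dip ([] , []) D

≼-size⇒≡ : ∀ {ν p} → IsPartition ν → IsPartition p → ν ≼ p → size p ∸ size ν ≡ 0 → ν ≡ p
≼-size⇒≡ {ν} {p} ν-part p-part ν≼p eq =
  partition-≡ ν-part p-part (≼-rows-≡ ν p ν≼p (m∸n≡0⇒m≤n eq))

flat-dip : ∀ {p ν q} → Dip p ν q 0 → ν ≡ p × ν ≡ q
flat-dip {p} {ν} δ =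
  ≼-size⇒≡ (ν-part δ) (p-part δ) (ν≼p δ) (m+n≡0⇒m≡0 (size p ∸ size ν) (weight δ)) ,
  ≼-size⇒≡ (ν-part δ) (q-part δ) (ν≼q δ) (m+n≡0⇒n≡0 (size p ∸ size ν) (weight δ))

Tracks : ∀ {c p xs q} → Dec c p xs q → (ℕ → List ℕ) → (ℕ → List ℕ) → Set
Tracks D s s' = ∀ k → peak D k ≡ s k × valley D k ≡ s' k

-- Beyond the parts of `c` every dip has weight 0, so the sequence is constant there, and `N`
-- identifies the constant as `q`. The start is an equation because `S 0` is only propositionally
-- empty.
dips⇒dec : ∀ c {p q s s'} → (∀ k → Dip (s k) (s' k) (s (suc k)) (row c k)) →
  (∃ λ N → ∀ k → N ≤ k → s k ≡ q) → p ≡ s 0 → ∃ λ xs → Σ (Dec c p xs q) λ D → Tracks D s s'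
dips⇒dec [] {s = s} {s'} dip (N , s≡q) refl = [] , stop (trans (constant N) (s≡q N ≤-refl)) , tracks
  where
  constant : ∀ k → s 0 ≡ s k
  constant zero    = refl
  constant (suc k) = trans (constant k) (trans (sym (proj₁ (flat-dip (dip k)))) (proj₂ (flat-dip (dip k))))
  valleys : ∀ k → s 0 ≡ s' k
  valleys k = trans (constant k) (sym (proj₁ (flat-dip (dip k))))
  tracks : ∀ k → _ × _
  tracks zero    = refl , valleys 0
  tracks (suc k) = constant (suc k) , valleys (suc k)
dips⇒dec (m ∷ c) {s = s} {s'} dip (N , s≡q) refl =
  let δ = dip 0
      ds , d = strip⇒down (p-part δ) (ν-part δ) (ν≼p δ) (p-strip δ)
      as , u = strip⇒up (ν-part δ) (q-part δ) (ν≼q δ) (q-strip δ)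
      ys , D , t = dips⇒dec c (dip ∘ suc) (N , λ k N≤k → s≡q (suc k) (m≤n⇒m≤1+n N≤k)) refl
  in ds ++ as ++ ys , cut d u (trans (sym (weight δ)) (chain-weight d u)) D ,
     λ { zero → refl , refl ; (suc k) → t k }

-- The first valley and the peak after it fix the chains of a run. This serves both congruence and
-- surjectivity of the bijection.
dec-unique : ∀ {c p xs xs' q q'} (D : Dec c p xs q) (D' : Dec c p xs' q') → Tracks D (peak D') (valley D') → xs ≡ xs'
dec-unique (stop _) (stop _) t = refl
dec-unique (cut d u _ D) (cut d' u' _ D') t with proj₂ (t 0) | proj₁ (t 1)
... | refl | refl = cong₂ _++_ (down-unique d d') (cong₂ _++_ (up-unique u u') (dec-unique D D' (t ∘ suc)))

up-split : ∀ {b b' ν as as' r r' ys ys'} → Up b ν as r → Up b' ν as' r' → length as ≡ length as' →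
  as ++ ys ≡ as' ++ ys' → r ≡ r' × ys ≡ ys'
up-split []          []            _   eq = refl , eq
up-split (add _ _ u) (add _ _ u') len eq with ∷-injective eq
... | refl , eq' = up-split u u' (suc-injective len) eq'

¬add-both : ∀ {i i' ν μ} → Add i ν μ → Add i' μ ν → ⊥
¬add-both A A' = <-asym (≤-reflexive (sym (add-size A))) (≤-reflexive (sym (add-size A')))

-- Equal lengths make the two runs end at the same vertex. Their turning points agree as well:
-- otherwise one common step would be a deletion in one reading and an addition in the other.
chain-split : ∀ {a a' b b' p ds ds' ν ν' as as' r r' ys ys'} →
  Down a p ds ν → Up b ν as r → Down a' p ds' ν' → Up b' ν' as' r' →
  length ds + length as ≡ length ds' + length as' → ds ++ as ++ ys ≡ ds' ++ as' ++ ys' →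
  ν ≡ ν' × r ≡ r' × ys ≡ ys'
chain-split []          u           []           u'           len eq = refl , up-split u u' len eq
chain-split []          (add _ A _) (del _ A' _) _            len eq with ∷-injective eq
... | refl , _ = ⊥-elim (¬add-both A A')
chain-split (del _ A _) _           []           (add _ A' _) len eq with ∷-injective eq
... | refl , _ = ⊥-elim (¬add-both A A')
chain-split (del _ _ d) u           (del _ _ d') u'           len eq with ∷-injective eq
... | refl , eq' = chain-split d u d' u' (suc-injective len) eq'

dec-functional : ∀ {c p xs xs' q q'} (D : Dec c p xs q) (D' : Dec c p xs' q') → xs ≡ xs' → Tracks D (peak D') (valley D')
dec-functional (stop _)         (stop _)             _  zero    = refl , refl
dec-functional (stop _)         (stop _)             _  (suc k) = refl , refl
dec-functional (cut d u len D)  (cut d' u' len' D')  eq k with chain-split d u d' u' (trans (sym len) len') eq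
dec-functional (cut d u _ D)    (cut d' u' _ D')     eq zero    | refl , refl , eq' = refl , refl
dec-functional (cut d u _ D)    (cut d' u' _ D')     eq (suc k) | refl , refl , eq' = dec-functional D D' eq' k

-- Walks as oscillating tableaux

walk-part : ∀ {p xs q} → IsPartition p → Walk p xs q → ∀ j → IsPartition (lookup (p ∷ fromList xs) j)
walk-part p-part w          fzero    = p-part
walk-part p-part (up A w)   (fsuc j) = walk-part (target A) w j
walk-part p-part (down A w) (fsuc j) = walk-part (source A) w j

walk-last : ∀ {p xs q} → Walk p xs q → lookup (p ∷ fromList xs) (fromℕ (length xs)) ≡ q
walk-last []         = refl
walk-last (up A w)   = walk-last w
walk-last (down A w) = walk-last w

walk-step : ∀ {p xs q} → Walk p xs q → ∀ j →
  (lookup (p ∷ fromList xs) (inject₁ j) ◁ lookup (p ∷ fromList xs) (fsuc j))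
  ⊎ (lookup (p ∷ fromList xs) (fsuc j) ◁ lookup (p ∷ fromList xs) (inject₁ j))
walk-step (up A w)   fzero    = inj₁ (add⇒◁ A)
walk-step (down A w) fzero    = inj₂ (add⇒◁ A)
walk-step (up A w)   (fsuc j) = walk-step w j
walk-step (down A w) (fsuc j) = walk-step w j

walk⇒OT : ∀ {n xs λ'} → Walk [] xs λ' → length xs ≡ n → Σ (OT n λ') λ τ → toList (O τ) ≡ [] ∷ xs
walk⇒OT {xs = xs} w refl = record
  { O      = [] ∷ fromList xs
  ; O-part = walk-part ([] , []) w
  ; O-init = refl
  ; O-last = walk-last w
  ; O-step = walk-step w
  } , cong ([] ∷_) (toList∘fromList xs)

vec⇒walk : ∀ {n p q} (v : Vec (List ℕ) n) → (∀ j → IsPartition (lookup (p ∷ v) j)) → lookup (p ∷ v) (fromℕ n) ≡ q →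
  (∀ j → (lookup (p ∷ v) (inject₁ j) ◁ lookup (p ∷ v) (fsuc j)) ⊎ (lookup (p ∷ v) (fsuc j) ◁ lookup (p ∷ v) (inject₁ j))) →
  Walk p (toList v) q
vec⇒walk []      part refl adjacent = []
vec⇒walk (x ∷ v) part last adjacent with adjacent fzero
... | inj₁ p◁x = up (◁⇒add (part fzero) (part (fsuc fzero)) p◁x) (vec⇒walk v (part ∘ fsuc) last (adjacent ∘ fsuc))
... | inj₂ x◁p = down (◁⇒add (part (fsuc fzero)) (part fzero) x◁p) (vec⇒walk v (part ∘ fsuc) last (adjacent ∘ fsuc))

OT⇒walk : ∀ {n λ'} (τ : OT n λ') → ∃ λ xs → Walk [] xs λ' × toList (O τ) ≡ [] ∷ xs
OT⇒walk record { O = p ∷ v ; O-part = part ; O-init = refl ; O-last = last ; O-step = adjacent } =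
  toList v , vec⇒walk v part last adjacent , refl

-- Both weighted sets in terms of decompositions, and the bijection

OTWeight⇒dec : ∀ {n c λ'} ((τ , _) : OTWeight λ' n c) → ∃ λ xs → Dec c [] xs λ' × toList (O τ) ≡ [] ∷ xs
OTWeight⇒dec {c = c} (τ , ref) =
  let xs , w , eq = OT⇒walk τ
      s = start-unflat c (ref⇒start (steps ([] ∷ xs)) (subst (λ vs → InRef (flat c) (desList (steps vs))) eq ref))
  in xs , walk⇒dec c w s , eq

dec⇒OTWeight : ∀ {n c xs λ'} → Dec c [] xs λ' → sum c ≡ n → Σ (OTWeight λ' n c) λ (τ , _) → toList (O τ) ≡ [] ∷ xs
dec⇒OTWeight {c = c} D sum≡n =
  let τ , eq = walk⇒OT (dec⇒walk D) (trans (dec-length D) sum≡n)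
      ref = start⇒ref (flat-positive c) (start-flat (dec⇒start D))
  in (τ , subst (λ vs → InRef (flat c) (desList (steps vs))) (sym eq) ref) , eq

SSOTWeight⇒dec : ∀ {n c λ'} ((τ , _) : SSOTWeight λ' n c) → ∃ λ xs → Σ (Dec c [] xs λ') λ D → Tracks D (S τ) (S′ τ)
SSOTWeight⇒dec {c = c} (τ , mult≡ , _) = dips⇒dec c
  (λ k → subst (Dip _ _ _) (mult≡ (suc k)) (ssot⇒dip τ k))
  (proj₁ (eventually τ) , λ k N≤k → proj₁ (proj₂ (eventually τ) k N≤k))
  (sym (S-zero τ))

dec⇒SSOTWeight : ∀ {n c xs λ'} → Dec c [] xs λ' → sum c ≡ n → SSOTWeight λ' n c
dec⇒SSOTWeight {c = c} D sum≡n = dec⇒ssot D , mults , sum≡n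
  where
  mults : ∀ k → mult (dec⇒ssot D) k ≡ wpart c k
  mults zero    = refl
  mults (suc k) = weight (dec⇒dip ([] , []) D k)

OT-≡ : ∀ {n λ'} (τ τ' : OT n λ') → toList (O τ) ≡ toList (O τ') → O τ ≡ O τ'
OT-≡ τ τ' eq = trans (sym (cast-is-id refl (O τ))) (toList-injective refl (O τ) (O τ') eq)

theorem2p21 : (λ' : List ℕ) → IsPartition λ' → (n : ℕ) → InN λ' n →
    (c : List ℕ) → Bijection (SSOTWeightSetoid λ' n c) (OTWeightSetoid λ' n c)
theorem2p21 λ' _ n _ c = record
  { to        = to
  ; cong      = λ {A} {B} → to-cong {A} {B}
  ; bijective = (λ {A} {B} → to-injective {A} {B}) , to-surjective
  }
  where
  chain : SSOTWeight λ' n c → List (List ℕ)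
  chain A = proj₁ (SSOTWeight⇒dec A)

  dec : (A : SSOTWeight λ' n c) → Dec c [] (chain A) λ'
  dec A = proj₁ (proj₂ (SSOTWeight⇒dec A))

  tracks : (A : SSOTWeight λ' n c) → Tracks (dec A) (S (proj₁ A)) (S′ (proj₁ A))
  tracks A = proj₂ (proj₂ (SSOTWeight⇒dec A))

  _≈_ : SSOTWeight λ' n c → SSOTWeight λ' n c → Set
  A ≈ B = ∀ k → S (proj₁ A) k ≡ S (proj₁ B) k × S′ (proj₁ A) k ≡ S′ (proj₁ B) k

  to : SSOTWeight λ' n c → OTWeight λ' n c
  to A = proj₁ (dec⇒OTWeight (dec A) (proj₂ (proj₂ A)))

  to-vertices : ∀ A → toList (O (proj₁ (to A))) ≡ [] ∷ chain A
  to-vertices A = proj₂ (dec⇒OTWeight (dec A) (proj₂ (proj₂ A)))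

  -- An arbitrary `D` is allowed because surjectivity applies this to a decomposition read off from
  -- an oscillating tableau.
  chain-unique : ∀ A {xs} (D : Dec c [] xs λ') → (∀ k → S (proj₁ A) k ≡ peak D k × S′ (proj₁ A) k ≡ valley D k) →
    chain A ≡ xs
  chain-unique A D eq = dec-unique (dec A) D λ k →
    trans (proj₁ (tracks A k)) (proj₁ (eq k)) , trans (proj₂ (tracks A k)) (proj₂ (eq k))

  to-cong : ∀ {A B} → A ≈ B → O (proj₁ (to A)) ≡ O (proj₁ (to B))
  to-cong {A} {B} A≈B = OT-≡ (proj₁ (to A)) (proj₁ (to B))
    (trans (to-vertices A) (trans (cong ([] ∷_) chains) (sym (to-vertices B))))
    where
    chains : chain A ≡ chain B
    chains = chain-unique A (dec B) λ k →
      trans (proj₁ (A≈B k)) (sym (proj₁ (tracks B k))) , trans (proj₂ (A≈B k)) (sym (proj₂ (tracks B k)))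

  to-injective : ∀ {A B} → O (proj₁ (to A)) ≡ O (proj₁ (to B)) → A ≈ B
  to-injective {A} {B} eq k =
    trans (sym (proj₁ (tracks A k))) (trans (proj₁ (same k)) (proj₁ (tracks B k))) ,
    trans (sym (proj₂ (tracks A k))) (trans (proj₂ (same k)) (proj₂ (tracks B k)))
    where
    same : Tracks (dec A) (peak (dec B)) (valley (dec B))
    same = dec-functional (dec A) (dec B)
      (proj₂ (∷-injective (trans (sym (to-vertices A)) (trans (cong toList eq) (to-vertices B)))))

  to-surjective : ∀ y → Σ (SSOTWeight λ' n c) λ x → ∀ {z} → z ≈ x → O (proj₁ (to z)) ≡ O (proj₁ y)
  to-surjective y@(τ , _) = let xs , D , vertices = OTWeight⇒dec y in
    dec⇒SSOTWeight D (total D vertices) ,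
    λ {z} z≈x → OT-≡ (proj₁ (to z)) τ (trans (to-vertices z) (trans (cong ([] ∷_) (chain-unique z D z≈x)) (sym vertices)))
    where
    -- `OTWeight` does not store `sum c ≡ n`; it is recovered by counting the vertices of the
    -- tableau.
    total : ∀ {xs} → Dec c [] xs λ' → toList (O τ) ≡ [] ∷ xs → sum c ≡ n
    total D vertices = trans (sym (dec-length D))
      (suc-injective (trans (sym (cong length vertices)) (length-toList (O τ))))
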